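{- Fix $n \geq 2$. Then $\delta_n(k_0)$ is a perfect square for at most finitely many nonzero integers $k_0$.
   Context: The polynomials $\delta_n, \varepsilon_n \in \mathbb{Z}[k]$, $n \geq 1$, are defined by $(\delta_1(k),\varepsilon_1(k)) = (2k^2, k)$ and, for $n \geq 2$, $\delta_n(k) = \delta_{n-1}(k)^2 + \varepsilon_{n-1}(k)^2$, $\varepsilon_n(k) = \delta_{n-1}(k)\varepsilon_{n-1}(k)/k$. -}

module Defs where

open import Data.Nat using (ℕ; zero; suc)
open import Data.Integer using (ℤ; _+_; _*_; +_; NonZero)
open import Data.Integer.DivMod using (_/_)
open import Data.Product using (_×_; _,_; proj₁; proj₂)

-- (δ_n(k), ε_n(k)) evaluated at a nonzero integer k, indexed so that
-- δε zero = (δ_1(k), ε_1(k)) = (2k², k), and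
-- δε (suc m) = (δ² + ε², δ ε / k) from δε m.
-- Since ε_n(k) = δ_{n-1}(k) ε_{n-1}(k) / k is an exact polynomial division
-- in ℤ[k], evaluating at k ≠ 0 with exact integer division gives the
-- value of the polynomial ε_n at k.
δε : (k : ℤ) .{{_ : NonZero k}} → ℕ → ℤ × ℤ
δε k zero = (+ 2 * (k * k) , k)
δε k (suc m) with δε k m
... | (d , e) = (d * d + e * e , (d * e) / k)

-- δ_n(k) for n ≥ 1 (δ k 0 is unused junk mapped to δ_1).
δ : (n : ℕ) (k : ℤ) .{{_ : NonZero k}} → ℤ
δ zero    k = proj₁ (δε k zero)
δ (suc n) k = proj₁ (δε k n)

ε : (n : ℕ) (k : ℤ) .{{_ : NonZero k}} → ℤ
ε zero    k = proj₂ (δε k zero)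
ε (suc n) k = proj₂ (δε k n)

IsSquare : ℤ → Set
IsSquare z = Data.Product.Σ ℤ (λ m → z ≡ m * m)
  where open import Relation.Binary.PropositionalEquality using (_≡_)

{-# OPTIONS --safe #-}
module Submission where

-- Runge's method.  For n ≥ 2, δₙ has even degree 2d and square leading
-- coefficient, so M² δₙ = q² + r with an integer M ≠ 0, deg q = d and deg r < d.
-- If δₙ(k) is a square and ∣k∣ is large, then ∣r(k)∣ < ∣q(k)∣ forces r(k) = 0,
-- so finiteness can only fail if r = 0 identically.  But then M² δₙ(1) would be
-- a square, whereas δₙ(1) ≡ 2 (mod 3).

open import Defs
open import Data.Nat using (ℕ; _≤_)
open import Data.Integer using (ℤ; ∣_∣; NonZero)
open import Data.Product using (Σ)

open import Data.Nat as ℕ using (zero; suc; z≤n; s≤s; _<_)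
import Data.Nat.Properties as ℕ
open import Data.Nat.Induction using (<-wellFounded)
open import Data.Nat.Tactic.RingSolver using () renaming (solve-∀ to solveℕ-∀)
open import Data.Integer using (+_; -_; _+_; _-_; _*_; _^_; 0ℤ; 1ℤ)
open import Data.Integer.DivMod using (_/_; _%_; n%d<d; a≡a%n+[a/n]*n)
open import Data.Integer.Properties
open import Data.Integer.Tactic.RingSolver using (solve-∀)
open import Data.Product using (_×_; _,_; proj₁; proj₂; ∃)
open import Data.Sum using (_⊎_; inj₁; inj₂; [_,_]′)
open import Data.Empty using (⊥-elim)
open import Function using (_∘_)
open import Induction.WellFounded using (Acc; acc)
open import Relation.Nullary using (yes; no; contradiction)
open import Relation.Binary.PropositionalEquality

-- Degree bounds and leading terms of integer polynomials.

-- Polynomials are represented by their functions ℤ → ℤ.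

-- The bound on the degree is strict, so index 0 is left for the zero polynomial. The coefficient
-- `a` in `term` may vanish, which makes raising the bound a matter of adding zero terms.
data DegBelow : ℕ → (ℤ → ℤ) → Set where
  null : ∀ {f} → (∀ x → f x ≡ 0ℤ) → DegBelow 0 f
  term : ∀ {n f g} a → DegBelow n g → (∀ x → f x ≡ a * x ^ n + g x) →
         DegBelow (suc n) f

-- Nonvanishing of `a` is kept apart and assumed only where growth is at stake.
record Leading (n : ℕ) (a : ℤ) (f : ℤ → ℤ) : Set where
  constructor leading
  field
    rest       : ℤ → ℤ
    rest-below : DegBelow n rest
    expansion  : ∀ x → f x ≡ a * x ^ n + rest x

leading⇒below : ∀ {n a f} → Leading n a f → DegBelow (suc n) f
leading⇒below {a = a} (leading _ dg eq) = term a dg eq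

below-cong : ∀ {n f g} → (∀ x → f x ≡ g x) → DegBelow n f → DegBelow n g
below-cong f≗g (null eq)      = null λ x → trans (sym (f≗g x)) (eq x)
below-cong f≗g (term a dh eq) = term a dh λ x → trans (sym (f≗g x)) (eq x)

below-zero : ∀ n → DegBelow n (λ _ → 0ℤ)
below-zero zero    = null λ _ → refl
below-zero (suc n) = term 0ℤ (below-zero n) λ _ → refl

below-suc : ∀ {n f} → DegBelow n f → DegBelow (suc n) f
below-suc df = term 0ℤ df λ x → sym (+-identityˡ _)

below-≤ : ∀ {m n f} → m ≤ n → DegBelow m f → DegBelow n f
below-≤ m≤n = go (ℕ.≤⇒≤′ m≤n)
  where
  go : ∀ {m n f} → m ℕ.≤′ n → DegBelow m f → DegBelow n f
  go ℕ.≤′-refl     df = df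
  go (ℕ.≤′-step p) df = below-suc (go p df)

below-+ : ∀ {n f g} → DegBelow n f → DegBelow n g → DegBelow n (λ x → f x + g x)
below-+ (null p) (null q) = null λ x → cong₂ _+_ (p x) (q x)
below-+ (term a df p) (term b dg q) =
  term (a + b) (below-+ df dg) λ x → trans (cong₂ _+_ (p x) (q x)) (collect a b _ _ _)
  where
  collect : ∀ a b t u v → (a * t + u) + (b * t + v) ≡ (a + b) * t + (u + v)
  collect = solve-∀

below-scale : ∀ {n f} c → DegBelow n f → DegBelow n (λ x → c * f x)
below-scale c (null p) = null λ x → trans (cong (c *_) (p x)) (*-zeroʳ c)
below-scale c (term a df p) =
  term (c * a) (below-scale c df) λ x → trans (cong (c *_) (p x)) (expand c a _ _)
  where
  expand : ∀ c a t u → c * (a * t + u) ≡ (c * a) * t + c * u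
  expand = solve-∀

below-x* : ∀ {n f} → DegBelow n f → DegBelow (suc n) (λ x → x * f x)
below-x* (null p) = below-suc (null λ x → trans (cong (x *_) (p x)) (*-zeroʳ x))
below-x* (term a df p) =
  term a (below-x* df) λ x → trans (cong (x *_) (p x)) (expand x a _ _)
  where
  expand : ∀ x a t u → x * (a * t + u) ≡ a * (x * t) + x * u
  expand = solve-∀

below-x^* : ∀ {n f} m → DegBelow n f → DegBelow (m ℕ.+ n) (λ x → x ^ m * f x)
below-x^* zero    df = below-cong (λ x → sym (*-identityˡ _)) df
below-x^* (suc m) df =
  below-cong (λ x → sym (*-assoc x (x ^ m) _)) (below-x* (below-x^* m df))

below-x^ : ∀ m → DegBelow (suc m) (λ x → x ^ m)
below-x^ m = term 1ℤ (below-zero m) λ x → sym (trans (+-identityʳ _) (*-identityˡ _))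

-- With strict bounds one unit is lost: deg f < m and deg g ≤ n give deg fg < m + n. The index
-- `suc n` expresses the second bound without a predecessor.
below-* : ∀ {m n f g} → DegBelow m f → DegBelow (suc n) g →
          DegBelow (m ℕ.+ n) (λ x → f x * g x)
below-* {n = n} {g = g} (null p) dg =
  below-cong (λ x → sym (cong (_* g x) (p x))) (below-zero n)
below-* {suc m} {n} {g = g} (term a df p) dg =
  below-cong (λ x → sym (trans (cong (_* g x) (p x)) (expand a _ _ _)))
    (below-+ (below-scale a (subst (λ k → DegBelow k (λ x → x ^ m * g x)) (ℕ.+-suc m n) (below-x^* m dg)))
             (below-suc (below-* df dg)))
  where
  expand : ∀ a t u v → (a * t + u) * v ≡ a * (t * v) + u * v
  expand = solve-∀

leading-x* : ∀ {n a f} → Leading n a f → Leading (suc n) a (λ x → x * f x)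
leading-x* {a = a} (leading g dg p) =
  leading _ (below-x* dg) λ x → trans (cong (x *_) (p x)) (expand x a _ _)
  where
  expand : ∀ x a t u → x * (a * t + u) ≡ a * (x * t) + x * u
  expand = solve-∀

leading-+ : ∀ {n a f g} → Leading n a f → DegBelow n g → Leading n a (λ x → f x + g x)
leading-+ {n} {a} {g = g} (leading h dh p) dg =
  leading _ (below-+ dh dg) λ x → trans (cong (_+ g x) (p x)) (+-assoc (a * x ^ n) (h x) (g x))

leading-* : ∀ {m n a b f g} → Leading m a f → Leading n b g →
            Leading (m ℕ.+ n) (a * b) (λ x → f x * g x)
leading-* {m} {n} {a} {b} {f} {g} (leading f₀ df₀ p) lg@(leading g₀ dg₀ q) =
  leading _ (below-+ (below-scale a (below-x^* m dg₀)) (below-* df₀ (leading⇒below lg))) eq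
  where
  expand : ∀ a b s t u v → (a * s + u) * (b * t + v) ≡
           (a * b) * (s * t) + (a * (s * v) + u * (b * t + v))
  expand = solve-∀
  eq : ∀ x → f x * g x ≡ (a * b) * x ^ (m ℕ.+ n) +
       (a * (x ^ m * g₀ x) + f₀ x * g x)
  eq x rewrite p x | q x | ^-distribˡ-+-* x m n = expand a b (x ^ m) (x ^ n) (f₀ x) (g₀ x)

-- Growth at infinity and bounds on roots.

-- This is f = O(∣x∣ⁿ⁻¹), multiplied through by ∣x∣ so that it also makes sense for n = 0. For ∣x∣ ≥
-- 1 the lower powers are absorbed into the top one.
below-growth : ∀ {n f} → DegBelow n f →
  ∃ λ B → ∀ x → 1 ≤ ∣ x ∣ → ∣ f x ∣ ℕ.* ∣ x ∣ ≤ B ℕ.* ∣ x ^ n ∣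
below-growth (null p) = 0 , λ x _ → ℕ.≤-reflexive (cong (λ z → ∣ z ∣ ℕ.* ∣ x ∣) (p x))
below-growth {suc n} {f} (term {g = g} a dg p) with below-growth dg
... | B , bound = ∣ a ∣ ℕ.+ B , growth
  where
  open ℕ.≤-Reasoning
  expand : ∀ a b t y → a ℕ.* t ℕ.* y ℕ.+ b ℕ.* (y ℕ.* t) ≡ (a ℕ.+ b) ℕ.* (y ℕ.* t)
  expand = solveℕ-∀
  growth : ∀ x → 1 ≤ ∣ x ∣ → ∣ f x ∣ ℕ.* ∣ x ∣ ≤ (∣ a ∣ ℕ.+ B) ℕ.* ∣ x ^ suc n ∣
  growth x 1≤x = begin
    ∣ f x ∣ ℕ.* ∣ x ∣
      ≡⟨ cong (λ z → ∣ z ∣ ℕ.* ∣ x ∣) (p x) ⟩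
    ∣ a * x ^ n + g x ∣ ℕ.* ∣ x ∣
      ≤⟨ ℕ.*-monoˡ-≤ ∣ x ∣ (∣i+j∣≤∣i∣+∣j∣ (a * x ^ n) (g x)) ⟩
    (∣ a * x ^ n ∣ ℕ.+ ∣ g x ∣) ℕ.* ∣ x ∣
      ≡⟨ cong (λ z → (z ℕ.+ ∣ g x ∣) ℕ.* ∣ x ∣) (abs-* a (x ^ n)) ⟩
    (∣ a ∣ ℕ.* ∣ x ^ n ∣ ℕ.+ ∣ g x ∣) ℕ.* ∣ x ∣
      ≡⟨ ℕ.*-distribʳ-+ (∣ x ∣) (∣ a ∣ ℕ.* ∣ x ^ n ∣) (∣ g x ∣) ⟩
    ∣ a ∣ ℕ.* ∣ x ^ n ∣ ℕ.* ∣ x ∣ ℕ.+ ∣ g x ∣ ℕ.* ∣ x ∣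
      ≤⟨ ℕ.+-monoʳ-≤ (∣ a ∣ ℕ.* ∣ x ^ n ∣ ℕ.* ∣ x ∣) (bound x 1≤x) ⟩
    ∣ a ∣ ℕ.* ∣ x ^ n ∣ ℕ.* ∣ x ∣ ℕ.+ B ℕ.* ∣ x ^ n ∣
      ≤⟨ ℕ.+-monoʳ-≤ (∣ a ∣ ℕ.* ∣ x ^ n ∣ ℕ.* ∣ x ∣)
           (ℕ.*-monoʳ-≤ B (ℕ.m≤n*m (∣ x ^ n ∣) (∣ x ∣) {{ℕ.>-nonZero 1≤x}})) ⟩
    ∣ a ∣ ℕ.* ∣ x ^ n ∣ ℕ.* ∣ x ∣ ℕ.+ B ℕ.* (∣ x ∣ ℕ.* ∣ x ^ n ∣)
      ≡⟨ expand (∣ a ∣) B (∣ x ^ n ∣) (∣ x ∣) ⟩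
    (∣ a ∣ ℕ.+ B) ℕ.* (∣ x ∣ ℕ.* ∣ x ^ n ∣)
      ≡⟨ cong ((∣ a ∣ ℕ.+ B) ℕ.*_) (abs-* x (x ^ n)) ⟨
    (∣ a ∣ ℕ.+ B) ℕ.* ∣ x ^ suc n ∣ ∎

1≤∣i∣ : ∀ {i} → i ≢ 0ℤ → 1 ≤ ∣ i ∣
1≤∣i∣ i≢0 = ℕ.n≢0⇒n>0 (i≢0 ∘ ∣i∣≡0⇒i≡0)

-- If ∣f∣ ≤ ∣r∣ at x, then ∣x∣ⁿ ≤ ∣a xⁿ∣ ≤ ∣r∣ + ∣g∣ with g the lower part of f. Multiplying by ∣x∣
-- and applying the growth bounds of r and g leaves ∣x∣ ≤ C + B.
leading-dominates : ∀ {n a f r} → Leading n a f → a ≢ 0ℤ → DegBelow n r →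
  ∃ λ B → ∀ x → ∣ f x ∣ ≤ ∣ r x ∣ → ∣ x ∣ ≤ B
leading-dominates {n} {a} {f} {r} (leading g dg p) a≢0 dr
  with below-growth dg | below-growth dr
... | B , boundg | C , boundr = C ℕ.+ B , dom
  where
  open ℕ.≤-Reasoning
  isolate : ∀ a t u → a * t ≡ (a * t + u) - u
  isolate = solve-∀
  dom : ∀ x → ∣ f x ∣ ≤ ∣ r x ∣ → ∣ x ∣ ≤ C ℕ.+ B
  dom x f≤r with x ≟ 0ℤ
  ... | yes refl = z≤n
  ... | no x≢0 = ℕ.*-cancelʳ-≤ (∣ x ∣) (C ℕ.+ B) (∣ x ^ n ∣) {{ℕ.>-nonZero xⁿ>0}} (begin
    ∣ x ∣ ℕ.* ∣ x ^ n ∣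
      ≤⟨ ℕ.*-monoʳ-≤ ∣ x ∣ (ℕ.m≤n*m (∣ x ^ n ∣) (∣ a ∣) {{ℕ.>-nonZero (1≤∣i∣ a≢0)}}) ⟩
    ∣ x ∣ ℕ.* (∣ a ∣ ℕ.* ∣ x ^ n ∣)
      ≡⟨ cong (∣ x ∣ ℕ.*_) (abs-* a (x ^ n)) ⟨
    ∣ x ∣ ℕ.* ∣ a * x ^ n ∣
      ≡⟨ cong (λ z → ∣ x ∣ ℕ.* ∣ z ∣)
           (trans (isolate a (x ^ n) (g x)) (cong (_- g x) (sym (p x)))) ⟩
    ∣ x ∣ ℕ.* ∣ f x - g x ∣
      ≤⟨ ℕ.*-monoʳ-≤ ∣ x ∣ (∣i-j∣≤∣i∣+∣j∣ (f x) (g x)) ⟩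
    ∣ x ∣ ℕ.* (∣ f x ∣ ℕ.+ ∣ g x ∣)
      ≤⟨ ℕ.*-monoʳ-≤ ∣ x ∣ (ℕ.+-monoˡ-≤ ∣ g x ∣ f≤r) ⟩
    ∣ x ∣ ℕ.* (∣ r x ∣ ℕ.+ ∣ g x ∣)
      ≡⟨ trans (ℕ.*-comm (∣ x ∣) _) (ℕ.*-distribʳ-+ (∣ x ∣) (∣ r x ∣) (∣ g x ∣)) ⟩
    ∣ r x ∣ ℕ.* ∣ x ∣ ℕ.+ ∣ g x ∣ ℕ.* ∣ x ∣
      ≤⟨ ℕ.+-mono-≤ (boundr x (1≤∣i∣ x≢0)) (boundg x (1≤∣i∣ x≢0)) ⟩
    C ℕ.* ∣ x ^ n ∣ ℕ.+ B ℕ.* ∣ x ^ n ∣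
      ≡⟨ ℕ.*-distribʳ-+ (∣ x ^ n ∣) C B ⟨
    (C ℕ.+ B) ℕ.* ∣ x ^ n ∣ ∎)
    where
    xⁿ>0 : 1 ≤ ∣ x ^ n ∣
    xⁿ>0 = 1≤∣i∣ (x≢0 ∘ i^n≡0⇒i≡0 x n)

-- Zero top coefficients are discarded until a nonzero one appears. A root is then a point where f
-- fails to dominate the zero polynomial.
roots-bounded : ∀ {n f} → DegBelow n f →
  (∀ x → f x ≡ 0ℤ) ⊎ (∃ λ B → ∀ x → f x ≡ 0ℤ → ∣ x ∣ ≤ B)
roots-bounded (null p) = inj₁ p
roots-bounded {suc n} (term a dg p) with a ≟ 0ℤ
... | no a≢0 with leading-dominates (leading _ dg p) a≢0 (below-zero n)
...   | B , dom = inj₂ (B , λ x fx≡0 → dom x (ℕ.≤-reflexive (cong ∣_∣ fx≡0)))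
roots-bounded {suc n} (term a dg p) | yes refl =
  [ (λ z → inj₁ λ x → trans (f≗g x) (z x))
  , (λ (B , b) → inj₂ (B , λ x fx≡0 → b x (trans (sym (f≗g x)) fx≡0))) ]′
  (roots-bounded dg)
  where f≗g = λ x → trans (p x) (+-identityˡ _)

-- Completing the square up to a remainder of low degree.

*-≢0 : ∀ i j → i ≢ 0ℤ → j ≢ 0ℤ → i * j ≢ 0ℤ
*-≢0 i j i≢0 j≢0 = [ i≢0 , j≢0 ]′ ∘ i*j≡0⇒i≡0∨j≡0 i

-- `q` over `M` approximates a polynomial square root of f, with `M` clearing denominators. The
-- index e counts the coefficients of `r`, in degrees d to d + e - 1, that remain to be cancelled.
record SquareUpTo (d e : ℕ) (f : ℤ → ℤ) : Set where
  field
    M a : ℤ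
    q r : ℤ → ℤ
    M≢0 : M ≢ 0ℤ
    a≢0 : a ≢ 0ℤ
    q-leading : Leading d a q
    r-below   : DegBelow (d ℕ.+ e) r
    split     : ∀ x → M * M * f x ≡ q x * q x + r x

-- Replacing q by 2aq + ρxᵉ, where ρ is the coefficient of x^(d+e) in r,
-- cancels that coefficient.
square-step : ∀ {d e f} → e < d → SquareUpTo d (suc e) f → SquareUpTo d e f
square-step {d} {e} {f} e<d S
  with subst (λ k → DegBelow k (SquareUpTo.r S)) (ℕ.+-suc d e) (SquareUpTo.r-below S)
     | SquareUpTo.q-leading S
... | term {g = r₀} ρ dr₀ r≗ | leading q₀ dq₀ q≗ = record
  { M   = + 2 * a * M
  ; a   = + 2 * a * a
  ; q   = λ x → + 2 * a * q x + ρ * x ^ e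
  -- This is 4a²(q² + r) - (2aq + ρxᵉ)². Its terms in degree d + e, 4a²ρ from r and -4aρ · a from
  -- the cross product, cancel.
  ; r   = λ x → + 4 * a * a * r₀ x + (- (+ 4 * a * ρ) * (x ^ e * q₀ x)
                + - (ρ * ρ) * (x ^ e * x ^ e))
  ; M≢0 = *-≢0 (+ 2 * a) M (*-≢0 (+ 2) a (λ ()) a≢0) M≢0
  ; a≢0 = *-≢0 (+ 2 * a) a (*-≢0 (+ 2) a (λ ()) a≢0) a≢0
  ; q-leading = leading _ (below-+ (below-scale (+ 2 * a) dq₀) (below-scale ρ (below-≤ e<d (below-x^ e))))
                  λ x → trans (cong (λ z → + 2 * a * z + ρ * x ^ e) (q≗ x)) (new-q a (x ^ d) (q₀ x) _)
  ; r-below = below-+ (below-scale (+ 4 * a * a) dr₀) (below-+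
      (below-scale (- (+ 4 * a * ρ))
        (subst (λ k → DegBelow k (λ x → x ^ e * q₀ x)) (ℕ.+-comm e d) (below-x^* e dq₀)))
      -- The square of the correction has degree 2e, and `e<d` puts this below d + e.
      (below-scale (- (ρ * ρ))
        (below-≤ (ℕ.+-monoˡ-≤ e e<d) (below-* (below-x^ e) (below-x^ e)))))
  ; split = new-split
  }
  where
  open SquareUpTo S using (M; a; q; r; M≢0; a≢0; split)
  new-q : ∀ a t u v → + 2 * a * (a * t + u) + v ≡ + 2 * a * a * t + (+ 2 * a * u + v)
  new-q = solve-∀
  scale : ∀ a M y → + 2 * a * M * (+ 2 * a * M) * y ≡ + 4 * a * a * (M * M * y)
  scale = solve-∀
  complete : ∀ a ρ t s u v →
    + 4 * a * a * ((a * t + u) * (a * t + u) + (ρ * (t * s) + v)) ≡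
    (+ 2 * a * (a * t + u) + ρ * s) * (+ 2 * a * (a * t + u) + ρ * s) +
    (+ 4 * a * a * v + (- (+ 4 * a * ρ) * (s * u) + - (ρ * ρ) * (s * s)))
  complete = solve-∀
  new-split : ∀ x → + 2 * a * M * (+ 2 * a * M) * f x ≡
    (+ 2 * a * q x + ρ * x ^ e) * (+ 2 * a * q x + ρ * x ^ e) +
    (+ 4 * a * a * r₀ x + (- (+ 4 * a * ρ) * (x ^ e * q₀ x) + - (ρ * ρ) * (x ^ e * x ^ e)))
  new-split x = trans (scale a M (f x)) (trans (cong ((+ 4 * a * a) *_) (split x)) body)
    where
    body : + 4 * a * a * (q x * q x + r x) ≡
      (+ 2 * a * q x + ρ * x ^ e) * (+ 2 * a * q x + ρ * x ^ e) +
      (+ 4 * a * a * r₀ x + (- (+ 4 * a * ρ) * (x ^ e * q₀ x) + - (ρ * ρ) * (x ^ e * x ^ e)))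
    body rewrite r≗ x | q≗ x | ^-distribˡ-+-* x d e = complete a ρ (x ^ d) (x ^ e) (q₀ x) (r₀ x)

square-descend : ∀ {d f} e → e ≤ d → SquareUpTo d e f → SquareUpTo d 0 f
square-descend zero    _   S = S
square-descend (suc e) e<d S = square-descend e (ℕ.<⇒≤ e<d) (square-step e<d S)

-- The start is M = 1 and q = c xᵈ, which matches only the leading term. The d coefficients of the
-- remainder in degrees 2d - 1 down to d are then removed one at a time.
complete-square : ∀ {d c f} → c ≢ 0ℤ → Leading (d ℕ.+ d) (c * c) f → SquareUpTo d 0 f
complete-square {d} {c} {f} c≢0 (leading g dg p) = square-descend d ℕ.≤-refl record
  { M = 1ℤ ; a = c ; q = λ x → c * x ^ d ; r = g
  ; M≢0 = λ () ; a≢0 = c≢0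
  ; q-leading = leading _ (below-zero d) λ x → sym (+-identityʳ _)
  ; r-below = dg
  ; split = start
  }
  where
  expand : ∀ c t u → 1ℤ * 1ℤ * (c * c * (t * t) + u) ≡ c * t * (c * t) + u
  expand = solve-∀
  start : ∀ x → 1ℤ * 1ℤ * f x ≡ c * x ^ d * (c * x ^ d) + g x
  start x rewrite p x | ^-distribˡ-+-* x d d = expand c (x ^ d) (g x)

-- Runge's dichotomy.

-- With s = y + q and t = y - q: r = s t, 2q = s - t, and ∣s∣ + ∣t∣ ≤ ∣s t∣ + 1 unless s t = 0.
square-gap : ∀ y q r → y * y ≡ q * q + r → ∣ r ∣ < ∣ q ∣ → r ≡ 0ℤ
square-gap y q r eq r<q with r ≟ 0ℤ
... | yes r≡0 = r≡0
... | no  r≢0 = contradiction r<q (ℕ.≤⇒≯ (ℕ.≤-pred (begin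
  1 ℕ.+ ∣ q ∣                ≤⟨ ℕ.+-monoˡ-≤ ∣ q ∣ (ℕ.≤-trans (s≤s z≤n) r<q) ⟩
  ∣ q ∣ ℕ.+ ∣ q ∣            ≡⟨ cong (∣ q ∣ ℕ.+_) (ℕ.+-identityʳ ∣ q ∣) ⟨
  2 ℕ.* ∣ q ∣                ≡⟨ abs-* (+ 2) q ⟨
  ∣ + 2 * q ∣                ≡⟨ cong ∣_∣ (double y q) ⟩
  ∣ (y + q) - (y - q) ∣      ≤⟨ ∣i-j∣≤∣i∣+∣j∣ (y + q) (y - q) ⟩
  ∣ y + q ∣ ℕ.+ ∣ y - q ∣    ≤⟨ sum≤product (λ z → r≢0 (trans r≡st (cong (_* (y - q)) (∣i∣≡0⇒i≡0 {y + q} z))))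
                                  (λ z → r≢0 (trans r≡st (trans (cong ((y + q) *_) (∣i∣≡0⇒i≡0 z)) (*-zeroʳ (y + q))))) ⟩
  1 ℕ.+ ∣ y + q ∣ ℕ.* ∣ y - q ∣  ≡⟨ cong suc (trans (cong ∣_∣ r≡st) (abs-* (y + q) (y - q))) ⟨
  1 ℕ.+ ∣ r ∣                ∎)))
  where
  open ℕ.≤-Reasoning
  double : ∀ y q → + 2 * q ≡ (y + q) - (y - q)
  double = solve-∀
  isolate : ∀ q r → r ≡ (q * q + r) - q * q
  isolate = solve-∀
  factor : ∀ y q → y * y - q * q ≡ (y + q) * (y - q)
  factor = solve-∀
  r≡st : r ≡ (y + q) * (y - q)
  r≡st = trans (isolate q r) (trans (cong (_- (q * q)) (sym eq)) (factor y q))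
  -- The excess of 1 + st over s + t is (s - 1)(t - 1), here written with both factors shifted by
  -- one.
  expand : ∀ s t → 1 ℕ.+ suc s ℕ.* suc t ≡ (suc s ℕ.+ suc t) ℕ.+ s ℕ.* t
  expand = solveℕ-∀
  sum≤product : ∀ {s t} → s ≢ 0 → t ≢ 0 → s ℕ.+ t ≤ 1 ℕ.+ s ℕ.* t
  sum≤product {zero}          s≢0 t≢0 = ⊥-elim (s≢0 refl)
  sum≤product {suc s} {zero}  s≢0 t≢0 = ⊥-elim (t≢0 refl)
  sum≤product {suc s} {suc t} s≢0 t≢0 =
    subst (suc s ℕ.+ suc t ≤_) (sym (expand s t)) (ℕ.m≤m+n (suc s ℕ.+ suc t) (s ℕ.* t))

-- The first alternative is the degenerate case of an identically zero remainder. It is stated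
-- pointwise, since a single value of x suffices to refute it.
runge : ∀ {d c f} → c ≢ 0ℤ → Leading (d ℕ.+ d) (c * c) f →
  (∃ λ M → M ≢ 0ℤ × ∀ x → ∃ λ q → M * M * f x ≡ q * q)
  ⊎ (∃ λ B → ∀ x → IsSquare (f x) → ∣ x ∣ ≤ B)
runge {d} {f = f} c≢0 lf = conclude (roots-bounded r-below′)
  where
  open SquareUpTo (complete-square {d = d} c≢0 lf)
  r-below′ : DegBelow d r
  r-below′ = subst (λ k → DegBelow k r) (ℕ.+-identityʳ d) r-below
  regroup : ∀ M y → M * y * (M * y) ≡ M * M * (y * y)
  regroup = solve-∀
  conclude : _ → _
  conclude (inj₁ r≗0) = inj₁ (M , M≢0 , λ x → q x ,
    trans (split x) (trans (cong (λ z → q x * q x + z) (r≗0 x)) (+-identityʳ _)))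
  conclude (inj₂ (B , roots)) with leading-dominates q-leading a≢0 r-below′
  ... | C , dom = inj₂ (B ℕ.⊔ C , bound)
    where
    bound : ∀ x → IsSquare (f x) → ∣ x ∣ ≤ B ℕ.⊔ C
    -- Either q fails to dominate r, which bounds x, or `square-gap` applied to (My)² = q² + r makes
    -- x a root of r.
    bound x (y , fx≡y²) with ∣ q x ∣ ℕ.≤? ∣ r x ∣
    ... | yes q≤r = ℕ.≤-trans (dom x q≤r) (ℕ.m≤n⊔m B C)
    ... | no  q≰r = ℕ.≤-trans (roots x (square-gap (M * y) (q x) (r x)
            (trans (regroup M y) (trans (cong ((M * M) *_) (sym fx≡y²)) (split x)))
            (ℕ.≰⇒> q≰r))) (ℕ.m≤m⊔n B C)

-- Squares modulo 3.

3*z≢1 : ∀ z → + 3 * z ≢ 1ℤ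
3*z≢1 z eq with ∣ z ∣ | trans (sym (abs-* (+ 3) z)) (cong ∣_∣ eq)
... | suc (suc _) | ()

-- The divisible case speaks of z rather than z², because the descent below divides z itself by 3.
square-mod-3 : ∀ z → (∃ λ m → z ≡ + 3 * m) ⊎ (∃ λ m → z * z ≡ + 3 * m + 1ℤ)
square-mod-3 z with z % + 3 | n%d<d z (+ 3) | z / + 3 | a≡a%n+[a/n]*n z (+ 3)
... | 0 | _ | m | eq = inj₁ (m , trans eq (rearrange m))
  where
  rearrange : ∀ m → 0ℤ + m * + 3 ≡ + 3 * m
  rearrange = solve-∀
... | 1 | _ | m | eq = inj₂ (+ 3 * m * m + + 2 * m , trans (cong₂ _*_ eq eq) (rearrange m))
  where
  rearrange : ∀ m → (1ℤ + m * + 3) * (1ℤ + m * + 3) ≡ + 3 * (+ 3 * m * m + + 2 * m) + 1ℤ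
  rearrange = solve-∀
... | 2 | _ | m | eq = inj₂ (+ 3 * m * m + + 4 * m + 1ℤ , trans (cong₂ _*_ eq eq) (rearrange m))
  where
  rearrange : ∀ m → (+ 2 + m * + 3) * (+ 2 + m * + 3) ≡ + 3 * (+ 3 * m * m + + 4 * m + 1ℤ) + 1ℤ
  rearrange = solve-∀
... | suc (suc (suc _)) | s≤s (s≤s (s≤s ())) | _ | _

-- Infinite descent on ∣M∣. Modulo 3 the equation reads 2M² ≡ q², which forces 3 to divide both M
-- and q; cancelling 9 gives a smaller solution.
nonresidue-mod-3 : ∀ w M q → M ≢ 0ℤ → M * M * (+ 3 * w + + 2) ≢ q * q
nonresidue-mod-3 w M = go M (<-wellFounded ∣ M ∣)
  where
  open ≡-Reasoning
  9-cancel : ∀ m p w → + 3 * m * (+ 3 * m) * (+ 3 * w + + 2) ≡ + 3 * p * (+ 3 * p) →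
             m * m * (+ 3 * w + + 2) ≡ p * p
  9-cancel m p w eq = *-cancelˡ-≡ (+ 9) _ _ (trans (sym (left m w)) (trans eq (right p)))
    where
    left : ∀ m w → + 3 * m * (+ 3 * m) * (+ 3 * w + + 2) ≡ + 9 * (m * m * (+ 3 * w + + 2))
    left = solve-∀
    right : ∀ p → + 3 * p * (+ 3 * p) ≡ + 9 * (p * p)
    right = solve-∀
  go : ∀ M → Acc _<_ ∣ M ∣ → ∀ q → M ≢ 0ℤ → M * M * (+ 3 * w + + 2) ≢ q * q
  go M (acc rs) q M≢0 eq with square-mod-3 M | square-mod-3 q
  ... | inj₁ (m , refl) | inj₁ (p , refl) =
        go m (rs smaller) p m≢0 (9-cancel m p w eq)
    where
    m≢0 : m ≢ 0ℤ
    m≢0 refl = M≢0 refl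
    smaller : ∣ m ∣ < ∣ + 3 * m ∣
    smaller = subst (∣ m ∣ <_) (sym (trans (abs-* (+ 3) m) (ℕ.*-comm 3 (∣ m ∣))))
      (ℕ.m<m*n (∣ m ∣) 3 {{ℕ.>-nonZero (1≤∣i∣ m≢0)}} (s≤s (s≤s z≤n)))
  -- In this and the next two cases the equation modulo 3 reads 0 ≡ 1, 2 ≡ 0 and 2 ≡ 1; each is
  -- rearranged into 3z = 1.
  ... | inj₁ (m , refl) | inj₂ (p , q²) =
        3*z≢1 (+ 3 * (m * m * (+ 3 * w + + 2)) - p) (begin
    + 3 * (+ 3 * (m * m * (+ 3 * w + + 2)) - p)
      ≡⟨ rearrange m w p ⟩
    + 3 * m * (+ 3 * m) * (+ 3 * w + + 2) - + 3 * p
      ≡⟨ cong (_- (+ 3 * p)) (trans eq q²) ⟩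
    + 3 * p + 1ℤ - + 3 * p
      ≡⟨ cancel p ⟩
    1ℤ ∎)
    where
    rearrange : ∀ m w p → + 3 * (+ 3 * (m * m * (+ 3 * w + + 2)) - p) ≡
                + 3 * m * (+ 3 * m) * (+ 3 * w + + 2) - + 3 * p
    rearrange = solve-∀
    cancel : ∀ p → + 3 * p + 1ℤ - + 3 * p ≡ 1ℤ
    cancel = solve-∀
  ... | inj₂ (m , M²) | inj₁ (p , refl) =
        3*z≢1 (u - + 3 * (p * p)) (begin
    + 3 * (u - + 3 * (p * p))
      ≡⟨ rearrange m w p ⟩
    (+ 3 * m + 1ℤ) * (+ 3 * w + + 2) + 1ℤ - + 3 * p * (+ 3 * p)
      ≡⟨ cong (λ z → z + 1ℤ - + 3 * p * (+ 3 * p)) (trans (cong (_* (+ 3 * w + + 2)) (sym M²)) eq) ⟩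
    + 3 * p * (+ 3 * p) + 1ℤ - + 3 * p * (+ 3 * p)
      ≡⟨ cancel (+ 3 * p * (+ 3 * p)) ⟩
    1ℤ ∎)
    where
    u = m * (+ 3 * w + + 2) + w + 1ℤ
    rearrange : ∀ m w p → + 3 * (m * (+ 3 * w + + 2) + w + 1ℤ - + 3 * (p * p)) ≡
                (+ 3 * m + 1ℤ) * (+ 3 * w + + 2) + 1ℤ - + 3 * p * (+ 3 * p)
    rearrange = solve-∀
    cancel : ∀ z → z + 1ℤ - z ≡ 1ℤ
    cancel = solve-∀
  ... | inj₂ (m , M²) | inj₂ (p , q²) =
        3*z≢1 (p - m * (+ 3 * w + + 2) - w) (begin
    + 3 * (p - m * (+ 3 * w + + 2) - w)
      ≡⟨ rearrange m w p ⟩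
    (+ 3 * p + 1ℤ) - (+ 3 * m + 1ℤ) * (+ 3 * w + + 2) + 1ℤ
      ≡⟨ cong (λ z → (+ 3 * p + 1ℤ) - z + 1ℤ)
           (trans (cong (_* (+ 3 * w + + 2)) (sym M²)) (trans eq q²)) ⟩
    (+ 3 * p + 1ℤ) - (+ 3 * p + 1ℤ) + 1ℤ
      ≡⟨ cancel (+ 3 * p + 1ℤ) ⟩
    1ℤ ∎)
    where
    rearrange : ∀ m w p → + 3 * (p - m * (+ 3 * w + + 2) - w) ≡
                (+ 3 * p + 1ℤ) - (+ 3 * m + 1ℤ) * (+ 3 * w + + 2) + 1ℤ
    rearrange = solve-∀
    cancel : ∀ z → z - z + 1ℤ ≡ 1ℤ
    cancel = solve-∀

-- The polynomials δₙ and εₙ: exact division, degrees, values at 1.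

[z*k]/k≡z : ∀ z k .{{_ : NonZero k}} → (z * k) / k ≡ z
[z*k]/k≡z z k = sym (i-j≡0⇒i≡j z q (∣i∣≡0⇒i≡0 (ℕ.n<1⇒n≡0
    (ℕ.*-cancelʳ-< (∣ k ∣) (∣ z - q ∣) 1 (begin-strict
  ∣ z - q ∣ ℕ.* ∣ k ∣  ≡⟨ abs-* (z - q) k ⟨
  ∣ (z - q) * k ∣      ≡⟨ cong ∣_∣ remainder ⟩
  (z * k) % k          <⟨ n%d<d (z * k) k ⟩
  ∣ k ∣                ≡⟨ ℕ.*-identityˡ ∣ k ∣ ⟨
  1 ℕ.* ∣ k ∣          ∎)))))
  where
  open ℕ.≤-Reasoning
  q = (z * k) / k
  expand : ∀ z q k → (z - q) * k ≡ z * k - q * k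
  expand = solve-∀
  cancel : ∀ r s → r + s - s ≡ r
  cancel = solve-∀
  -- The remainder is a multiple of k and smaller than ∣k∣, which forces ∣z - q∣ < 1.
  remainder : (z - q) * k ≡ + ((z * k) % k)
  remainder = trans (expand z q k)
    (trans (cong (_- (q * k)) (a≡a%n+[a/n]*n (z * k) k)) (cancel _ (q * k)))

-- δ_{m+1}(k) = k c_m(k) and ε_{m+1}(k) = k η_m(k).
c η : ℕ → ℤ → ℤ
c zero    x = + 2 * x
c (suc m) x = x * (c m x * c m x + η m x * η m x)
η zero    x = 1ℤ
η (suc m) x = c m x * η m x

-- Both components carry a factor k, so their product carries k²: one factor is cancelled by the
-- division, the other persists. Hence `c` and `η` obey a recursion free of division, to which the
-- degree calculus applies.
δε≡ : ∀ k .{{_ : NonZero k}} m → δε k m ≡ (k * c m k , k * η m k)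
δε≡ k zero = cong₂ _,_ (rearrange k) (sym (*-identityʳ k))
  where
  rearrange : ∀ k → + 2 * (k * k) ≡ k * (+ 2 * k)
  rearrange = solve-∀
δε≡ k (suc m) rewrite δε≡ k m = cong₂ _,_ (sum k (c m k) (η m k))
    (trans (cong (_/ k) (product k (c m k) (η m k))) ([z*k]/k≡z (k * (c m k * η m k)) k))
  where
  sum : ∀ k c η → k * c * (k * c) + k * η * (k * η) ≡ k * (k * (c * c + η * η))
  sum = solve-∀
  product : ∀ k c η → k * c * (k * η) ≡ k * (c * η) * k
  product = solve-∀

-- In closed form 2^(m+1) - 1, so x · `c m x` has degree 2^(m+1).
deg-c : ℕ → ℕ
deg-c zero    = 1
deg-c (suc m) = suc (deg-c m ℕ.+ deg-c m)

-- Since η has smaller degree than c, η² does not touch the leading term of c² + η². The degree of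
-- each next η in turn depends on that of c, hence the mutual induction.
η-below : ∀ m → DegBelow (deg-c m) (η m)
c-leading : ∀ m → ∃ λ a → a ≢ 0ℤ × Leading (deg-c m) a (c m)
-- Separated from `c-leading` so that the leading coefficient is visibly a square, as `runge`
-- demands.
c-suc-leading : ∀ m {a} → Leading (deg-c m) a (c m) →
                Leading (deg-c (suc m)) (a * a) (c (suc m))

η-below zero    = below-x^ 0
η-below (suc m) with c-leading m
... | a , _ , lc = below-suc (below-cong (λ x → *-comm (η m x) (c m x))
                     (below-* (η-below m) (leading⇒below lc)))

c-leading zero = + 2 , (λ ()) , leading _ (below-zero 1)
  λ x → sym (trans (+-identityʳ _) (cong (+ 2 *_) (*-identityʳ x)))
c-leading (suc m) with c-leading m
... | a , a≢0 , lc = a * a , *-≢0 a a a≢0 a≢0 , c-suc-leading m lc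

c-suc-leading m lc =
  leading-x* (leading-+ (leading-* lc lc) (below-* (η-below m) (below-suc (η-below m))))

-- The pair (c, η²) ≡ (2, 1) is fixed by the recursion: 4 + 1 ≡ 2 and 4 · 1 ≡ 1. The square of η is
-- tracked because η itself alternates between 1 and -1.
c,η-at-1-mod-3 : ∀ m → (∃ λ u → c m 1ℤ ≡ + 3 * u + + 2) × (∃ λ v → η m 1ℤ * η m 1ℤ ≡ + 3 * v + 1ℤ)
c,η-at-1-mod-3 zero = (0ℤ , refl) , (0ℤ , refl)
c,η-at-1-mod-3 (suc m) with c,η-at-1-mod-3 m
... | (u , cu) , (v , ηv) =
  (+ 3 * u * u + + 4 * u + v + 1ℤ , trans (cong₂ (λ s t → 1ℤ * (s * s + t)) cu ηv) (sum u v)) ,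
  ((+ 3 * u * u + + 4 * u + 1ℤ) * (+ 3 * v + 1ℤ) + v ,
    trans (regroup (c m 1ℤ) (η m 1ℤ)) (trans (cong₂ (λ s t → s * s * t) cu ηv) (product u v)))
  where
  sum : ∀ u v → 1ℤ * ((+ 3 * u + + 2) * (+ 3 * u + + 2) + (+ 3 * v + 1ℤ)) ≡
        + 3 * (+ 3 * u * u + + 4 * u + v + 1ℤ) + + 2
  sum = solve-∀
  regroup : ∀ s t → s * t * (s * t) ≡ s * s * (t * t)
  regroup = solve-∀
  product : ∀ u v → (+ 3 * u + + 2) * (+ 3 * u + + 2) * (+ 3 * v + 1ℤ) ≡
            + 3 * ((+ 3 * u * u + + 4 * u + 1ℤ) * (+ 3 * v + 1ℤ) + v) + 1ℤ
  product = solve-∀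

x*c-not-square-multiple : ∀ m M q → M ≢ 0ℤ → M * M * (1ℤ * c m 1ℤ) ≢ q * q
x*c-not-square-multiple m M q M≢0 eq with c,η-at-1-mod-3 m
... | (u , cu) , _ = nonresidue-mod-3 u M q M≢0
        (trans (cong ((M * M) *_) (sym (trans (*-identityˡ (c m 1ℤ)) cu))) eq)

x*c-squares-bounded : ∀ m → ∃ λ B → ∀ x → IsSquare (x * c (suc m) x) → ∣ x ∣ ≤ B
x*c-squares-bounded m = conclude (runge {d} {a} {f} a≢0 f-leading)
  where
  -- `c (suc m)` has degree 2 `deg-c m` + 1 and leading coefficient a², with a that of `c m`. The
  -- extra factor x makes the degree even, namely 2d.
  d = suc (deg-c m)
  a = proj₁ (c-leading m)
  a≢0 = proj₁ (proj₂ (c-leading m))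
  f : ℤ → ℤ
  f x = x * c (suc m) x
  f-leading : Leading (d ℕ.+ d) (a * a) f
  f-leading = subst (λ n → Leading n (a * a) f) (cong suc (sym (ℕ.+-suc (deg-c m) (deg-c m))))
    (leading-x* (c-suc-leading m (proj₂ (proj₂ (c-leading m)))))
  conclude : (∃ λ M → M ≢ 0ℤ × ∀ x → ∃ λ q → M * M * f x ≡ q * q)
             ⊎ (∃ λ B → ∀ x → IsSquare (f x) → ∣ x ∣ ≤ B) →
             ∃ λ B → ∀ x → IsSquare (f x) → ∣ x ∣ ≤ B
  conclude (inj₂ bounded) = bounded
  conclude (inj₁ (M , M≢0 , square)) =
    ⊥-elim (x*c-not-square-multiple (suc m) M (proj₁ (square 1ℤ)) M≢0 (proj₂ (square 1ℤ)))

theorem24 : (n : ℕ) → 2 ≤ n →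
    Σ ℕ (λ B → (k₀ : ℤ) .{{_ : NonZero k₀}} → IsSquare (δ n k₀) → ∣ k₀ ∣ ≤ B)
theorem24 (suc (suc m)) (s≤s (s≤s z≤n)) =
  -- The index drops by one: δ at n = m + 2 is the first component of `δε k (suc m)`, that is k ·
  -- `c (suc m) k`.
  proj₁ (x*c-squares-bounded m) , λ k sq →
    proj₂ (x*c-squares-bounded m) k (subst IsSquare (cong proj₁ (δε≡ k (suc m))) sq)
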